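{- Let $n\ge 4$ and let $x$ be a vertex of the path $P_n$ which is not a bad vertex (i.e. it is not the case that $n=5$ and $x$ is the middle vertex of $P_5$). Then there exists a $(P_n,x)$-good path 2-placement.
   Context: $P_n$ is the path on $n$ vertices; $dist$ is distance in $P_n$, $d(y)$ the degree of $y$ in $P_n$, $N(x)$ the set of neighbors of $x$. A permutation $\sigma$ of $V(P_n)$ is a 2-placement of $P_n$ if for every edge $ab$ of $P_n$, $\sigma(a)\sigma(b)$ is not an edge of $P_n$. $P_n^k$ is the $k$-th power of $P_n$; $\sigma(P_n)\subseteq P_n^k$ means $dist(\sigma(a),\sigma(b))\le k$ for every edge $ab$ of $P_n$. A fixed-point-free permutation $\sigma$ of $V(P_n)$ is a $(P_n,x)$-good path 2-placement if: (1) $\sigma$ is a 2-placement of $P_n$; (2) $\sigma(P_n)\subseteq P_n^5$; (3) $dist(x,\sigma(x))=1$; (4) $dist(y,\sigma(y))\le 2$ for every $y\in N(x)$ and for every $y$ with $d(y)=1$. -}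

module Defs where

open import Data.Nat.Base using (ℕ; suc; _≤_)
import Data.Nat.Properties as ℕ
open import Data.Fin.Base using (Fin; toℕ)
open import Data.Fin.Permutation using (Permutation′; _⟨$⟩ʳ_)
open import Data.Fin.Subset using (Subset; _∈_; ∣_∣)
open import Data.Product.Base using (∃-syntax; _×_)
open import Data.Sum.Base using (_⊎_; inj₁; inj₂; swap)
open import Data.Vec.Base using (tabulate)
open import Relation.Binary.Definitions using (Decidable; Irreflexive; Symmetric)
open import Relation.Binary.PropositionalEquality using (_≡_; _≢_; refl; sym)
open import Relation.Nullary using (¬_)
open import Relation.Nullary.Decidable using (does; _⊎-dec_)

record Graph (n : ℕ) : Set₁ where
  field
    Adj        : Fin n → Fin n → Set
    adj?       : Decidable Adj
    adj-sym    : Symmetric Adj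
    adj-irrefl : Irreflexive _≡_ Adj

module _ {n : ℕ} (G : Graph n) where

  open Graph G

  N : Fin n → Subset n
  N x = tabulate (λ y → does (adj? x y))

  degree : Fin n → ℕ
  degree x = ∣ N x ∣

  data Walk : Fin n → Fin n → ℕ → Set where
    []  : ∀ {u} → Walk u u 0
    _∷_ : ∀ {u v w ℓ} → Adj u v → Walk v w ℓ → Walk u w (suc ℓ)

  -- Graph distance as a relation, because it is undefined between vertices in
  -- different components: Dist u v d says that dist(u, v) = d.
  Dist : Fin n → Fin n → ℕ → Set
  Dist u v d = Walk u v d × (∀ {ℓ} → Walk u v ℓ → d ≤ ℓ)

  Dist≤ : Fin n → Fin n → ℕ → Set
  Dist≤ u v k = ∃[ d ] (Dist u v d × d ≤ k)

  Is2Placement : Permutation′ n → Set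
  Is2Placement σ = ∀ a b → Adj a b → ¬ Adj (σ ⟨$⟩ʳ a) (σ ⟨$⟩ʳ b)

  -- σ(G) ⊆ Gᵏ
  ImageInPower : Permutation′ n → ℕ → Set
  ImageInPower σ k = ∀ a b → Adj a b → Dist≤ (σ ⟨$⟩ʳ a) (σ ⟨$⟩ʳ b) k

FixedPointFree : ∀ {n} → Permutation′ n → Set
FixedPointFree σ = ∀ v → σ ⟨$⟩ʳ v ≢ v

P : (n : ℕ) → Graph n
P n = record
  { Adj        = λ i j → toℕ j ≡ suc (toℕ i) ⊎ toℕ i ≡ suc (toℕ j)
  ; adj?       = λ i j → (toℕ j ℕ.≟ suc (toℕ i)) ⊎-dec (toℕ i ℕ.≟ suc (toℕ j))
  ; adj-sym    = swap
  ; adj-irrefl = λ { refl (inj₁ i≡1+i) → ℕ.1+n≢n (sym i≡1+i)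
                   ; refl (inj₂ i≡1+i) → ℕ.1+n≢n (sym i≡1+i) }
  }

record IsGoodPath2Placement (n : ℕ) (x : Fin n) (σ : Permutation′ n) : Set where
  field
    fixedPointFree : FixedPointFree σ
    is2Placement   : Is2Placement (P n) σ
    imageInP⁵      : ImageInPower (P n) σ 5
    dist-x         : Dist (P n) x (σ ⟨$⟩ʳ x) 1
    dist-N         : ∀ y → y ∈ N (P n) x → Dist≤ (P n) y (σ ⟨$⟩ʳ y) 2
    dist-leaf      : ∀ y → degree (P n) y ≡ 1 → Dist≤ (P n) y (σ ⟨$⟩ʳ y) 2

-- Vertices are numbered from 0, so the middle vertex of P₅ is 2.
BadVertex : (n : ℕ) → Fin n → Set
BadVertex n x = n ≡ 5 × toℕ x ≡ 2

{-# OPTIONS --safe #-}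
-- If σ and τ are fixed-point-free placements moving the end vertices of their
-- paths by 1 or 2, then so is σ ⊕ τ on the concatenated path: the edge in the
-- middle is stretched to length 1 + d + e with d, e ∈ {1, 2}, hence between 3
-- and 5.  Displacements are unchanged, so σ ⊕ τ is good wherever σ or τ is.
-- Splitting off the first four vertices reduces every path to one with at most
-- seven vertices; only vertex 6 of P₉ would lead to the bad vertex of P₅, and
-- there the path is split as P₅ followed by P₄ instead.
module Submission where

open import Defs
open import Data.Nat.Base using (ℕ; _≥_)
open import Data.Fin.Base using (Fin)
open import Data.Fin.Permutation using (Permutation′)
open import Data.Product.Base using (Σ-syntax)
open import Relation.Nullary using (¬_)

open import Data.Fin.Base using (zero; suc; toℕ; fromℕ<; _↑ˡ_; _↑ʳ_; splitAt)
open import Data.Fin.Patterns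
open import Data.Fin.Permutation using (permutation; _⟨$⟩ʳ_)
import Data.Fin.Properties as Fin
open import Data.Fin.Subset using (_∈_)
open import Data.Fin.Subset.Properties using (x∈p⇒∣p-x∣<∣p∣; x∈p∧x≢y⇒x∈p-y)
open import Data.List.Base using (List; []; _∷_)
open import Data.List.Relation.Unary.Any using (Any; any?; satisfied)
open import Data.Nat.Base using (zero; suc; _+_; _∸_; _≤_; _<_; z≤n; s≤s; ∣_-_∣)
import Data.Nat.Properties as ℕ
open import Data.Product.Base using (_×_; _,_; proj₁; proj₂)
open import Data.Sum.Base using (_⊎_; inj₁; inj₂; swap)
open import Data.Sum.Function.Propositional using (_⊎-↔_)
open import Data.Vec.Base using (Vec; lookup; []; _∷_)
open import Data.Vec.Properties using ([]=⇒lookup; lookup⇒[]=; lookup∘tabulate)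
open import Function.Base using (_∘_)
open import Function.Construct.Composition using (_↔-∘_)
open import Function.Construct.Symmetry using (↔-sym)
open import Relation.Binary.PropositionalEquality
  using (_≡_; _≢_; refl; sym; trans; cong; cong₂; subst; module ≡-Reasoning)
open import Relation.Nullary using (Dec; yes; no; contradiction)
open import Relation.Nullary.Decidable
  using (True; toWitness; from-yes; does; dec-true; ¬?; _×-dec_; _⊎-dec_; _→-dec_)
open import Relation.Unary using (Decidable)

open Graph using (Adj; adj?)

private
  variable
    m n : ℕ

-- Distances in a path

∣1+n-n∣≡1 : ∀ n → ∣ suc n - n ∣ ≡ 1
∣1+n-n∣≡1 zero    = refl
∣1+n-n∣≡1 (suc n) = ∣1+n-n∣≡1 n

Adj⇒∣-∣≡1 : {a b : Fin n} → Adj (P n) a b → ∣ toℕ a - toℕ b ∣ ≡ 1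
Adj⇒∣-∣≡1 {a = a} (inj₁ b≡1+a) rewrite b≡1+a = trans (ℕ.∣-∣-comm (toℕ a) _) (∣1+n-n∣≡1 (toℕ a))
Adj⇒∣-∣≡1 {b = b} (inj₂ a≡1+b) rewrite a≡1+b = ∣1+n-n∣≡1 (toℕ b)

∣-∣≤length : ∀ {u v : Fin n} {ℓ} → Walk (P n) u v ℓ → ∣ toℕ u - toℕ v ∣ ≤ ℓ
∣-∣≤length {u = u} [] = ℕ.≤-reflexive (ℕ.∣n-n∣≡0 (toℕ u))
∣-∣≤length {u = u} {v} (_∷_ {v = w} {ℓ = ℓ} u~w p) = begin
  ∣ toℕ u - toℕ v ∣                     ≤⟨ ℕ.∣-∣-triangle (toℕ u) (toℕ w) (toℕ v) ⟩
  ∣ toℕ u - toℕ w ∣ + ∣ toℕ w - toℕ v ∣ ≤⟨ ℕ.+-mono-≤ (ℕ.≤-reflexive (Adj⇒∣-∣≡1 u~w)) (∣-∣≤length p) ⟩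
  suc ℓ                                 ∎
  where open ℕ.≤-Reasoning

ascent : ∀ d (u v : Fin n) → toℕ v ≡ d + toℕ u → Walk (P n) u v d
ascent zero    u v v≡u with refl ← Fin.toℕ-injective v≡u = []
ascent {n} (suc d) u v v≡1+d+u = inj₁ w≡1+u ∷ ascent d w v v≡d+w
  where
  1+u<n : suc (toℕ u) < n
  1+u<n = ℕ.≤-<-trans (subst (suc (toℕ u) ≤_) (sym v≡1+d+u) (s≤s (ℕ.m≤n+m (toℕ u) d))) (Fin.toℕ<n v)
  w = fromℕ< 1+u<n
  w≡1+u = Fin.toℕ-fromℕ< 1+u<n
  v≡d+w : toℕ v ≡ d + toℕ w
  v≡d+w rewrite w≡1+u = trans v≡1+d+u (sym (ℕ.+-suc d (toℕ u)))

descent : ∀ d (u v : Fin n) → toℕ u ≡ d + toℕ v → Walk (P n) u v d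
descent zero    u v u≡v with refl ← Fin.toℕ-injective u≡v = []
descent {n} (suc d) u v u≡1+d+v = inj₂ (trans u≡1+d+v (cong suc (sym w≡d+v))) ∷ descent d w v w≡d+v
  where
  d+v<n : d + toℕ v < n
  d+v<n = ℕ.<-trans (ℕ.≤-reflexive (sym u≡1+d+v)) (Fin.toℕ<n u)
  w = fromℕ< d+v<n
  w≡d+v = Fin.toℕ-fromℕ< d+v<n

-- A monotone walk attains the index difference, and no walk is shorter, since each step changes the
-- index by exactly one.
Dist-∣-∣ : (u v : Fin n) → Dist (P n) u v ∣ toℕ u - toℕ v ∣
Dist-∣-∣ {n} u v = walk , ∣-∣≤length
  where
  walk : Walk (P n) u v ∣ toℕ u - toℕ v ∣
  walk with ℕ.≤-total (toℕ u) (toℕ v)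
  ... | inj₁ u≤v rewrite ℕ.m≤n⇒∣m-n∣≡n∸m u≤v = ascent _ u v (sym (ℕ.m∸n+n≡m u≤v))
  ... | inj₂ v≤u rewrite ℕ.m≤n⇒∣n-m∣≡n∸m v≤u = descent _ u v (sym (ℕ.m∸n+n≡m v≤u))

∣-∣≤⇒Dist≤ : ∀ {u v : Fin n} {d} → ∣ toℕ u - toℕ v ∣ ≤ d → Dist≤ (P n) u v d
∣-∣≤⇒Dist≤ {u = u} {v} le = _ , Dist-∣-∣ u v , le

-- Neighbours and leaves

module _ (G : Graph n) where

  ∈N⇒Adj : ∀ {x y} → y ∈ N G x → Adj G x y
  -- Membership unfolds to `does (adj? G x y) ≡ true`; abstracting the decision in it as well makes
  -- the `no` case `false ≡ true`.
  ∈N⇒Adj {x} {y} y∈N with adj? G x y | trans (sym (lookup∘tabulate (λ z → does (adj? G x z)) y)) ([]=⇒lookup y∈N)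
  ... | yes x~y | _  = x~y
  ... | no  _   | ()

  Adj⇒∈N : ∀ {x y} → Adj G x y → y ∈ N G x
  Adj⇒∈N {x} {y} x~y = lookup⇒[]= y _ (trans (lookup∘tabulate _ y) (dec-true (adj? G x y) x~y))

  -- Deleting `b` and then `a` from the neighbourhood lowers its cardinality strictly both times.
  degree≥2 : ∀ {x a b} → Adj G x a → Adj G x b → a ≢ b → 2 ≤ degree G x
  degree≥2 {x} {a} {b} x~a x~b a≢b = begin
    2                     ≤⟨ s≤s (ℕ.≤-trans (s≤s z≤n) (x∈p⇒∣p-x∣<∣p∣ a∈N-b)) ⟩
    suc _                 ≤⟨ x∈p⇒∣p-x∣<∣p∣ (Adj⇒∈N x~b) ⟩
    degree G x            ∎
    where
    open ℕ.≤-Reasoning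
    a∈N-b = x∈p∧x≢y⇒x∈p-y (Adj⇒∈N x~a) a≢b

IsEnd : Fin n → Set
IsEnd {n} y = toℕ y ≡ 0 ⊎ suc (toℕ y) ≡ n

-- By contraposition: a vertex that is neither first nor last has two distinct neighbours, one below
-- and one above.
leaf⇒IsEnd : (y : Fin n) → degree (P n) y ≡ 1 → IsEnd y
leaf⇒IsEnd     zero    _     = inj₁ refl
leaf⇒IsEnd {n} (suc y) deg≡1 with suc (suc (toℕ y)) ℕ.≟ n
... | yes last    = inj₂ last
... | no  notLast = contradiction (sym deg≡1) (ℕ.<⇒≢
  (degree≥2 (P n) (inj₂ (cong suc (sym below≡y))) (inj₁ above≡2+y) below≢above))
  where
  y<n : toℕ y < n
  y<n = ℕ.m<n⇒m<1+n (Fin.toℕ<n y)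
  2+y<n : suc (suc (toℕ y)) < n
  2+y<n = ℕ.≤∧≢⇒< (s≤s (Fin.toℕ<n y)) notLast
  below = fromℕ< y<n
  above = fromℕ< 2+y<n
  below≡y = Fin.toℕ-fromℕ< y<n
  above≡2+y = Fin.toℕ-fromℕ< 2+y<n
  below≢above : below ≢ above
  below≢above eq = ℕ.<⇒≢ (ℕ.m<n⇒m<1+n (ℕ.n<1+n (toℕ y))) (trans (sym below≡y) (trans (cong toℕ eq) above≡2+y))

-- An arithmetic, decidable form of goodness

δ : Permutation′ n → Fin n → ℕ
δ σ v = ∣ toℕ v - toℕ (σ ⟨$⟩ʳ v) ∣

-- Images of adjacent vertices are distinct, so non-adjacency amounts to distance at least 2; the
-- bound 5 is the fifth power.
Stretched : ℕ → ℕ → Set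
Stretched p q = 2 ≤ ∣ p - q ∣ × ∣ p - q ∣ ≤ 5

-- Collects the conditions that do not mention `x`, so that concatenation can preserve it; `GoodAt`
-- holds the others.
Placement : Permutation′ n → Set
Placement {n} σ =
  FixedPointFree σ ×
  (∀ a b → Adj (P n) a b → Stretched (toℕ (σ ⟨$⟩ʳ a)) (toℕ (σ ⟨$⟩ʳ b))) ×
  (∀ y → IsEnd y → δ σ y ≤ 2)

GoodAt : Fin n → Permutation′ n → Set
GoodAt {n} x σ = δ σ x ≡ 1 × (∀ y → Adj (P n) x y → δ σ y ≤ 2)

placement? : Decidable (Placement {n})
placement? {n} σ =
  Fin.all? (λ v → ¬? (σ ⟨$⟩ʳ v Fin.≟ v)) ×-dec
  Fin.all? (λ a → Fin.all? λ b → adj? (P n) a b →-dec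
    ((2 ℕ.≤? _) ×-dec (_ ℕ.≤? 5))) ×-dec
  Fin.all? (λ y → ((_ ℕ.≟ 0) ⊎-dec (_ ℕ.≟ n)) →-dec (_ ℕ.≤? 2))

goodAt? : (x : Fin n) → Decidable (GoodAt x)
goodAt? {n} x σ = (_ ℕ.≟ 1) ×-dec Fin.all? (λ y → adj? (P n) x y →-dec (_ ℕ.≤? 2))

GoodPlacement : (n : ℕ) → Fin n → Set
GoodPlacement n x = Σ[ σ ∈ Permutation′ n ] (Placement σ × GoodAt x σ)

isGood : ∀ {x} {σ : Permutation′ n} → Placement σ → GoodAt x σ → IsGoodPath2Placement n x σ
isGood {n} {x} {σ} (moves , stretch , ends) (δx≡1 , near) = record
  { fixedPointFree = moves
  ; is2Placement   = λ a b a~b σa~σb →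
      ℕ.<⇒≢ (proj₁ (stretch a b a~b)) (sym (Adj⇒∣-∣≡1 σa~σb))
  ; imageInP⁵      = λ a b a~b → ∣-∣≤⇒Dist≤ (proj₂ (stretch a b a~b))
  ; dist-x         = subst (Dist (P n) x (σ ⟨$⟩ʳ x)) δx≡1 (Dist-∣-∣ x (σ ⟨$⟩ʳ x))
  ; dist-N         = λ y y∈N → ∣-∣≤⇒Dist≤ (near y (∈N⇒Adj (P n) y∈N))
  ; dist-leaf      = λ y deg≡1 → ∣-∣≤⇒Dist≤ (ends y (leaf⇒IsEnd y deg≡1))
  }

-- Concatenation of placements

_⊕_ : Permutation′ m → Permutation′ n → Permutation′ (m + n)
σ ⊕ τ = ↔-sym Fin.+↔⊎ ↔-∘ ((σ ⊎-↔ τ) ↔-∘ Fin.+↔⊎)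

-- A view: matching on it puts a vertex into the form `i ↑ˡ n` or `m ↑ʳ j`, on which the equations
-- for `σ ⊕ τ` can rewrite.
data Side (m n : ℕ) : Fin (m + n) → Set where
  left  : (i : Fin m) → Side m n (i ↑ˡ n)
  right : (j : Fin n) → Side m n (m ↑ʳ j)

side : ∀ m n (i : Fin (m + n)) → Side m n i
side m n i with splitAt m i | Fin.join-splitAt m n i
... | inj₁ j | refl = left j
... | inj₂ j | refl = right j

-- Since `toℕ i < m`, the equation `m + toℕ j ≡ suc (toℕ i)` is squeezed to equality on both sides;
-- the opposite orientation would place the left vertex beyond the right one.
junction : {i : Fin m} {j : Fin n} → Adj (P (m + n)) (i ↑ˡ n) (m ↑ʳ j) → suc (toℕ i) ≡ m × toℕ j ≡ 0
junction {m} {n} {i} {j} i~j rewrite Fin.toℕ-↑ˡ i n | Fin.toℕ-↑ʳ m j with i~j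
... | inj₂ i≡1+m+j = contradiction (subst (_< m) i≡1+m+j (Fin.toℕ<n i)) (ℕ.m+n≮m m _ ∘ ℕ.<-trans (ℕ.n<1+n _))
... | inj₁ m+j≡1+i = ℕ.≤-antisym (Fin.toℕ<n i) m≤1+i , ℕ.n≤0⇒n≡0 (ℕ.+-cancelˡ-≤ m _ _ m+j≤m+0)
  where
  m≤1+i = subst (m ≤_) m+j≡1+i (ℕ.m≤m+n m (toℕ j))
  m+j≤m+0 : m + toℕ j ≤ m + 0
  m+j≤m+0 rewrite m+j≡1+i | ℕ.+-identityʳ m = Fin.toℕ<n i

Adj-↑ˡ⁻ : ∀ {a b : Fin m} n → Adj (P (m + n)) (a ↑ˡ n) (b ↑ˡ n) → Adj (P m) a b
Adj-↑ˡ⁻ {a = a} {b} n a~b rewrite Fin.toℕ-↑ˡ a n | Fin.toℕ-↑ˡ b n = a~b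

Adj-↑ʳ⁻ : ∀ m {a b : Fin n} → Adj (P (m + n)) (m ↑ʳ a) (m ↑ʳ b) → Adj (P n) a b
Adj-↑ʳ⁻ zero    a~b        = a~b
Adj-↑ʳ⁻ (suc m) (inj₁ eq) = Adj-↑ʳ⁻ m (inj₁ (ℕ.suc-injective eq))
Adj-↑ʳ⁻ (suc m) (inj₂ eq) = Adj-↑ʳ⁻ m (inj₂ (ℕ.suc-injective eq))

IsEnd-↑ˡ⁻ : ∀ {i : Fin m} n → IsEnd (i ↑ˡ n) → IsEnd i
IsEnd-↑ˡ⁻ {m} {i} n end rewrite Fin.toℕ-↑ˡ i n with end
... | inj₁ first = inj₁ first
-- A left vertex is last overall only when `n` is zero; `m ≤ m + n` then makes it last on the left
-- too.
... | inj₂ last  = inj₂ (ℕ.≤-antisym (Fin.toℕ<n i) (subst (m ≤_) (sym last) (ℕ.m≤m+n m n)))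

IsEnd-↑ʳ⁻ : ∀ m {j : Fin n} → IsEnd (m ↑ʳ j) → IsEnd j
IsEnd-↑ʳ⁻ m {j} end rewrite Fin.toℕ-↑ʳ m j with end
... | inj₁ first = inj₁ (ℕ.m+n≡0⇒n≡0 m first)
... | inj₂ last  = inj₂ (ℕ.+-cancelˡ-≡ m _ _ (trans (ℕ.+-suc m (toℕ j)) last))

Stretched-sym : ∀ {p q} → Stretched p q → Stretched q p
Stretched-sym {p} {q} rewrite ℕ.∣-∣-comm p q = λ s → s

module _ (σ : Permutation′ m) (τ : Permutation′ n) where

  ⊕-↑ˡ : ∀ i → (σ ⊕ τ) ⟨$⟩ʳ (i ↑ˡ n) ≡ (σ ⟨$⟩ʳ i) ↑ˡ n
  ⊕-↑ˡ i rewrite Fin.splitAt-↑ˡ m i n = refl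

  ⊕-↑ʳ : ∀ j → (σ ⊕ τ) ⟨$⟩ʳ (m ↑ʳ j) ≡ m ↑ʳ (τ ⟨$⟩ʳ j)
  ⊕-↑ʳ j rewrite Fin.splitAt-↑ʳ m n j = refl

  toℕ-⊕-↑ˡ : ∀ i → toℕ ((σ ⊕ τ) ⟨$⟩ʳ (i ↑ˡ n)) ≡ toℕ (σ ⟨$⟩ʳ i)
  toℕ-⊕-↑ˡ i = trans (cong toℕ (⊕-↑ˡ i)) (Fin.toℕ-↑ˡ _ n)

  toℕ-⊕-↑ʳ : ∀ j → toℕ ((σ ⊕ τ) ⟨$⟩ʳ (m ↑ʳ j)) ≡ m + toℕ (τ ⟨$⟩ʳ j)
  toℕ-⊕-↑ʳ j = trans (cong toℕ (⊕-↑ʳ j)) (Fin.toℕ-↑ʳ m _)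

  δ-↑ˡ : ∀ i → δ (σ ⊕ τ) (i ↑ˡ n) ≡ δ σ i
  δ-↑ˡ i = cong₂ ∣_-_∣ (Fin.toℕ-↑ˡ i n) (toℕ-⊕-↑ˡ i)

  δ-↑ʳ : ∀ j → δ (σ ⊕ τ) (m ↑ʳ j) ≡ δ τ j
  δ-↑ʳ j = trans (cong₂ ∣_-_∣ (Fin.toℕ-↑ʳ m j) (toℕ-⊕-↑ʳ j)) (ℕ.∣m+n-m+o∣≡∣n-o∣ m _ _)

  module _ (σ-placement : Placement σ) (τ-placement : Placement τ) where

    private
      σ-moves = proj₁ σ-placement
      τ-moves = proj₁ τ-placement
      σ-stretch = proj₁ (proj₂ σ-placement)
      τ-stretch = proj₁ (proj₂ τ-placement)
      σ-ends = proj₂ (proj₂ σ-placement)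
      τ-ends = proj₂ (proj₂ τ-placement)

    junction-stretched : ∀ {i j} → suc (toℕ i) ≡ m → toℕ j ≡ 0 →
                         Stretched (toℕ (σ ⟨$⟩ʳ i)) (m + toℕ (τ ⟨$⟩ʳ j))
    junction-stretched {i} {j} 1+i≡m j≡0 =
      subst (λ e → 2 ≤ e × e ≤ 5) (sym gap)
        -- The gap is `suc d + q`: `1 ≤ d` gives the lower bound 2, and `d ≤ 2`, `q ≤ 2` give 1 + 2
        -- + 2.
        ( s≤s (ℕ.≤-trans 1≤d (ℕ.m≤m+n d q))
        , s≤s (ℕ.+-mono-≤ d≤2 q≤2))
      where
      p = toℕ (σ ⟨$⟩ʳ i)
      q = toℕ (τ ⟨$⟩ʳ j)
      d = toℕ i ∸ p
      -- The last vertex is not fixed and has nothing above it, so it moves strictly down; hence the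
      -- truncated `d` is its true displacement.
      p<i : p < toℕ i
      p<i = ℕ.≤∧≢⇒< (ℕ.≤-pred (subst (p <_) (sym 1+i≡m) (Fin.toℕ<n (σ ⟨$⟩ʳ i)))) (σ-moves i ∘ Fin.toℕ-injective)
      1≤d : 1 ≤ d
      1≤d = ℕ.m<n⇒0<n∸m p<i
      d≤2 : d ≤ 2
      d≤2 = subst (_≤ 2) (ℕ.m≤n⇒∣n-m∣≡n∸m (ℕ.<⇒≤ p<i)) (σ-ends i (inj₂ 1+i≡m))
      q≤2 : q ≤ 2
      -- The first vertex has index 0, so its displacement `∣ 0 - q ∣` is `q` itself.
      q≤2 = subst (λ z → ∣ z - q ∣ ≤ 2) j≡0 (τ-ends j (inj₁ j≡0))
      open ≡-Reasoning
      m+q≡p+e : m + q ≡ p + (suc d + q)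
      m+q≡p+e = begin
        m + q               ≡⟨ cong (_+ q) 1+i≡m ⟨
        suc (toℕ i) + q     ≡⟨ cong (λ z → suc z + q) (ℕ.m+[n∸m]≡n (ℕ.<⇒≤ p<i)) ⟨
        suc (p + d) + q     ≡⟨ cong (_+ q) (ℕ.+-suc p d) ⟨
        p + suc d + q       ≡⟨ ℕ.+-assoc p (suc d) q ⟩
        p + (suc d + q)     ∎
      gap : ∣ p - (m + q) ∣ ≡ suc d + q
      gap = trans (cong (∣ p -_∣) m+q≡p+e) (ℕ.∣m-m+n∣≡n p (suc d + q))

    ⊕-moves : FixedPointFree (σ ⊕ τ)
    ⊕-moves v with side m n v
    ... | left i  = λ eq → σ-moves i (Fin.↑ˡ-injective n _ _ (trans (sym (⊕-↑ˡ i)) eq))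
    ... | right j = λ eq → τ-moves j (Fin.↑ʳ-injective m _ _ (trans (sym (⊕-↑ʳ j)) eq))

    ⊕-stretch : ∀ a b → Adj (P (m + n)) a b →
                Stretched (toℕ ((σ ⊕ τ) ⟨$⟩ʳ a)) (toℕ ((σ ⊕ τ) ⟨$⟩ʳ b))
    ⊕-stretch a b a~b with side m n a | side m n b
    ... | left i  | left j  rewrite toℕ-⊕-↑ˡ i | toℕ-⊕-↑ˡ j = σ-stretch i j (Adj-↑ˡ⁻ n a~b)
    ... | left i  | right j rewrite toℕ-⊕-↑ˡ i | toℕ-⊕-↑ʳ j =
      let (last , first) = junction a~b in junction-stretched last first
    ... | right i | left j  rewrite toℕ-⊕-↑ʳ i | toℕ-⊕-↑ˡ j =
      let (last , first) = junction (swap a~b) in Stretched-sym {toℕ (σ ⟨$⟩ʳ j)} (junction-stretched last first)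
    ... | right i | right j rewrite toℕ-⊕-↑ʳ i | toℕ-⊕-↑ʳ j
                                  | ℕ.∣m+n-m+o∣≡∣n-o∣ m (toℕ (τ ⟨$⟩ʳ i)) (toℕ (τ ⟨$⟩ʳ j)) =
      τ-stretch i j (Adj-↑ʳ⁻ m a~b)

    ⊕-ends : ∀ y → IsEnd y → δ (σ ⊕ τ) y ≤ 2
    ⊕-ends y end with side m n y
    ... | left i  rewrite δ-↑ˡ i = σ-ends i (IsEnd-↑ˡ⁻ n end)
    ... | right j rewrite δ-↑ʳ j = τ-ends j (IsEnd-↑ʳ⁻ m end)

    ⊕-placement : Placement (σ ⊕ τ)
    ⊕-placement = ⊕-moves , ⊕-stretch , ⊕-ends

    -- A neighbour of `x` across the junction is the first vertex of the other path, which the end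
    -- condition in `Placement` moves by at most 2.
    ⊕-goodAtˡ : ∀ {x} → GoodAt x σ → GoodAt (x ↑ˡ n) (σ ⊕ τ)
    ⊕-goodAtˡ {x} (δx≡1 , near) = trans (δ-↑ˡ x) δx≡1 , near′
      where
      near′ : ∀ y → Adj (P (m + n)) (x ↑ˡ n) y → δ (σ ⊕ τ) y ≤ 2
      near′ y x~y with side m n y
      ... | left i  rewrite δ-↑ˡ i = near i (Adj-↑ˡ⁻ n x~y)
      ... | right j rewrite δ-↑ʳ j = τ-ends j (inj₁ (proj₂ (junction x~y)))

    ⊕-goodAtʳ : ∀ {x} → GoodAt x τ → GoodAt (m ↑ʳ x) (σ ⊕ τ)
    ⊕-goodAtʳ {x} (δx≡1 , near) = trans (δ-↑ʳ x) δx≡1 , near′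
      where
      near′ : ∀ y → Adj (P (m + n)) (m ↑ʳ x) y → δ (σ ⊕ τ) y ≤ 2
      near′ y x~y with side m n y
      ... | left i  rewrite δ-↑ˡ i = σ-ends i (inj₂ (proj₁ (junction (swap x~y))))
      ... | right j rewrite δ-↑ʳ j = near j (Adj-↑ʳ⁻ m x~y)

goodˡ : ∀ {x y} → GoodPlacement m x → GoodPlacement n y → GoodPlacement (m + n) (x ↑ˡ n)
goodˡ (σ , σ-pl , σ-good) (τ , τ-pl , _) = σ ⊕ τ , ⊕-placement σ τ σ-pl τ-pl , ⊕-goodAtˡ σ τ σ-pl τ-pl σ-good

goodʳ : ∀ {x y} → GoodPlacement m x → GoodPlacement n y → GoodPlacement (m + n) (m ↑ʳ y)
goodʳ (σ , σ-pl , _) (τ , τ-pl , τ-good) = σ ⊕ τ , ⊕-placement σ τ σ-pl τ-pl , ⊕-goodAtʳ σ τ σ-pl τ-pl τ-good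

-- Small paths

InverseTables : Vec (Fin n) n → Vec (Fin n) n → Set
InverseTables f g = (∀ i → lookup f (lookup g i) ≡ i) × (∀ i → lookup g (lookup f i) ≡ i)

inverseTables? : (f g : Vec (Fin n) n) → Dec (InverseTables f g)
inverseTables? f g = Fin.all? (λ i → _ Fin.≟ i) ×-dec Fin.all? (λ i → _ Fin.≟ i)

-- The implicit argument is solved by evaluating the decision, so a wrong inverse table is a type
-- error.
table : (f g : Vec (Fin n) n) {_ : True (inverseTables? f g)} → Permutation′ n
table f g {inv} = permutation (lookup f) (lookup g) (proj₁ (toWitness inv)) (proj₂ (toWitness inv))

-- The first is good at the two ends, its inverse at the two inner vertices.
placements₄ : List (Permutation′ 4)
placements₄ =
  table (1F ∷ 3F ∷ 0F ∷ 2F ∷ []) (2F ∷ 0F ∷ 3F ∷ 1F ∷ []) ∷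
  table (2F ∷ 0F ∷ 3F ∷ 1F ∷ []) (1F ∷ 3F ∷ 0F ∷ 2F ∷ []) ∷ []

-- The first is good at 0 and 3, its inverse at 1 and 4.
placements₅ : List (Permutation′ 5)
placements₅ =
  table (1F ∷ 3F ∷ 0F ∷ 4F ∷ 2F ∷ []) (2F ∷ 0F ∷ 4F ∷ 1F ∷ 3F ∷ []) ∷
  table (2F ∷ 0F ∷ 4F ∷ 1F ∷ 3F ∷ []) (1F ∷ 3F ∷ 0F ∷ 4F ∷ 2F ∷ []) ∷ []

-- Good at 0 and 5, at 3 and 4, and at 1 and 2, respectively.
placements₆ : List (Permutation′ 6)
placements₆ =
  table (1F ∷ 3F ∷ 0F ∷ 5F ∷ 2F ∷ 4F ∷ []) (2F ∷ 0F ∷ 4F ∷ 1F ∷ 5F ∷ 3F ∷ []) ∷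
  table (1F ∷ 4F ∷ 0F ∷ 2F ∷ 5F ∷ 3F ∷ []) (2F ∷ 0F ∷ 3F ∷ 5F ∷ 1F ∷ 4F ∷ []) ∷
  table (2F ∷ 0F ∷ 3F ∷ 5F ∷ 1F ∷ 4F ∷ []) (1F ∷ 4F ∷ 0F ∷ 2F ∷ 5F ∷ 3F ∷ []) ∷ []

-- Good at 0 and 3, at 4 and 5, at 3 and 6, and at 1 and 2, respectively.
placements₇ : List (Permutation′ 7)
placements₇ =
  table (1F ∷ 3F ∷ 0F ∷ 4F ∷ 6F ∷ 2F ∷ 5F ∷ []) (2F ∷ 0F ∷ 5F ∷ 1F ∷ 3F ∷ 6F ∷ 4F ∷ []) ∷
  table (2F ∷ 0F ∷ 5F ∷ 1F ∷ 3F ∷ 6F ∷ 4F ∷ []) (1F ∷ 3F ∷ 0F ∷ 4F ∷ 6F ∷ 2F ∷ 5F ∷ []) ∷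
  table (1F ∷ 4F ∷ 0F ∷ 2F ∷ 6F ∷ 3F ∷ 5F ∷ []) (2F ∷ 0F ∷ 3F ∷ 5F ∷ 1F ∷ 6F ∷ 4F ∷ []) ∷
  table (2F ∷ 0F ∷ 3F ∷ 5F ∷ 1F ∷ 6F ∷ 4F ∷ []) (1F ∷ 4F ∷ 0F ∷ 2F ∷ 6F ∷ 3F ∷ 5F ∷ []) ∷ []

good? : (σs : List (Permutation′ n)) (x : Fin n) → Dec (Any (λ σ → Placement σ × GoodAt x σ) σs)
good? σs x = any? (λ σ → placement? σ ×-dec goodAt? x σ) σs

good₄ : ∀ x → GoodPlacement 4 x
good₄ x = satisfied (from-yes (Fin.all? (good? placements₄)) x)

good₅ : ∀ x → toℕ x ≢ 2 → GoodPlacement 5 x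
good₅ x x≢2 = satisfied (from-yes (Fin.all? λ x → ¬? (toℕ x ℕ.≟ 2) →-dec good? placements₅ x) x x≢2)

good₆ : ∀ x → GoodPlacement 6 x
good₆ x = satisfied (from-yes (Fin.all? (good? placements₆)) x)

good₇ : ∀ x → GoodPlacement 7 x
good₇ x = satisfied (from-yes (Fin.all? (good? placements₇)) x)

goodPlacement : ∀ k (x : Fin (4 + k)) → ¬ BadVertex (4 + k) x → GoodPlacement (4 + k) x
goodPlacement 0 x _   = good₄ x
goodPlacement 1 x ¬bad = good₅ x (λ x≡2 → ¬bad (refl , x≡2))
goodPlacement 2 x _   = good₆ x
goodPlacement 3 x _   = good₇ x
goodPlacement (suc (suc (suc (suc k)))) x ¬bad with side 4 (4 + k) x
-- The half without `x` may be good at any of its vertices; `zero` is never bad.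
... | left i  = goodˡ (good₄ i) (goodPlacement k zero λ ())
... | right j with (4 + k ℕ.≟ 5) ×-dec (toℕ j ℕ.≟ 2)
...   | no  ¬bad′ = goodʳ (good₄ zero) (goodPlacement k j ¬bad′)
...   | yes (refl , j≡2) with refl ← Fin.toℕ-injective {j = 2F} j≡2 =
  -- Here `k` is 1. Both `4 ↑ʳ 2F` and `5 ↑ʳ 1F` compute to vertex 6 of the path on 9 vertices, so
  -- no transport is required.
  goodʳ (good₅ zero λ ()) (good₄ 1F)

theorem3p2 : (n : ℕ) → n ≥ 4 → (x : Fin n) → ¬ BadVertex n x → Σ[ σ ∈ Permutation′ n ] IsGoodPath2Placement n x σ
theorem3p2 _ (s≤s (s≤s (s≤s (s≤s {n = k} _)))) x ¬bad =
  let (σ , placement , goodAt) = goodPlacement k x ¬bad in σ , isGood placement goodAt
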